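{- For every pair of integers $n\ge 2$ and $1\le r\le n-1$, let $s:=\min\{r,n-r\}$. Then \[ \mathcal{K}^{\mathsf{TJ}}(J(n,r))= \begin{cases} \{k:k\ge 1\}, & s=1,\\ \{s\}, & s\ge 2\text{ and }n=2s,\\ \{s,n-s\}, & s\ge 2\text{ and }n>2s. \end{cases} \]
   Context: All graphs are finite, simple, undirected. A $k$-clique of a graph $H$ is a set of $k$ pairwise adjacent vertices. For a graph $H$ and integer $k\ge1$, the Token Jumping graph $\mathsf{TJ}_k(H)$ has as vertices the $k$-cliques of $H$, and two $k$-cliques $A,B$ are adjacent iff $|A\cap B|=k-1$. For a graph $G$, $\mathcal{K}^{\mathsf{TJ}}(G)=\{k\ge1:\ \exists\text{ a graph }H\text{ with }\mathsf{TJ}_k(H)\cong G\}$. The Johnson graph $J(n,r)$ has as vertices the $r$-subsets of $\{1,\dots,n\}$, two being adjacent iff their intersection has size $r-1$. -}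

module Defs where

open import Data.Fin using (Fin)
open import Data.Fin.Subset using (Subset; _∈_; _∩_; ∣_∣)
open import Data.Fin.Subset.Properties using (∩-comm; ∩-idem)
open import Data.Nat using (ℕ; suc; _≤_)
open import Data.Nat.Properties using (1+n≢n; _≟_)
open import Data.Product using (Σ-syntax; ∃-syntax; _×_; proj₁)
open import Data.Refinement using (Refinement; value; _,_)
open import Data.Irrelevant using ([_])
open import Function.Bundles using (_↔_; _⇔_; Inverse)
open import Level using (0ℓ) renaming (suc to lsuc)
open import Relation.Binary.Core using (Rel)
open import Relation.Binary.Definitions using (Decidable; Irreflexive; Symmetric)
open import Relation.Binary.PropositionalEquality
  using (_≡_; _≢_; refl; sym; trans; cong)
open import Relation.Nullary.Decidable using (recompute)
open import Relation.Unary using (Pred; U)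

-- Simple undirected graphs on the vertex type V. Finite graphs are, up to
-- isomorphism, those with V = Fin m. Adjacency is decidable, as it is
-- (classically) for every finite graph.
record Graph (V : Set) : Set₁ where
  field
    Adj    : Rel V 0ℓ
    adj?   : Decidable Adj
    symm   : Symmetric Adj
    irrefl : Irreflexive _≡_ Adj

open Graph public

record _≅_ {V W : Set} (G : Graph V) (H : Graph W) : Set where
  field
    bijection : V ↔ W
    adj⇔      : ∀ u v → Adj G u v ⇔ Adj H (Inverse.to bijection u) (Inverse.to bijection v)

-- Subsets of size k subject to a further condition P. The proofs of the
-- conditions are irrelevant, so that propositional equality of two such
-- subsets is equality of the underlying sets.
SubsetsOfSize : (m k : ℕ) → Pred (Subset m) 0ℓ → Set
SubsetsOfSize m k P = Refinement (Subset m) (λ A → ∣ A ∣ ≡ k × P A)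

size : ∀ {m k P} (A : SubsetsOfSize m k P) → ∣ value A ∣ ≡ k
size {k = k} (A , [ p ]) = recompute (∣ A ∣ ≟ k) (proj₁ p)

-- The condition ∣ A ∩ B ∣ = k - 1 is written suc ∣ A ∩ B ∣ ≡ k, which avoids
-- truncated subtraction.
tokenGraph : (m k : ℕ) (P : Pred (Subset m) 0ℓ) → Graph (SubsetsOfSize m k P)
tokenGraph m k P = record
  { Adj    = λ A B → suc ∣ value A ∩ value B ∣ ≡ k
  ; adj?   = λ A B → suc ∣ value A ∩ value B ∣ ≟ k
  ; symm   = λ {A} {B} e → trans (cong (λ C → suc ∣ C ∣) (∩-comm (value B) (value A))) e
  ; irrefl = λ { {A} refl e →
      1+n≢n (trans (cong (λ C → suc ∣ C ∣) (sym (∩-idem (value A))))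
                   (trans e (sym (size A)))) }
  }

PairwiseAdjacent : ∀ {m} → Graph (Fin m) → Pred (Subset m) 0ℓ
PairwiseAdjacent H A = ∀ u v → u ∈ A → v ∈ A → u ≢ v → Adj H u v

Clique : ∀ {m} → ℕ → Graph (Fin m) → Set
Clique {m} k H = SubsetsOfSize m k (PairwiseAdjacent H)

TJ : ∀ {m} (k : ℕ) (H : Graph (Fin m)) → Graph (Clique k H)
TJ {m} k H = tokenGraph m k (PairwiseAdjacent H)

𝒦TJ : ∀ {V} → Graph V → Pred ℕ (lsuc 0ℓ)
𝒦TJ G k = 1 ≤ k × ∃[ m ] Σ[ H ∈ Graph (Fin m) ] TJ k H ≅ G

J : (n r : ℕ) → Graph (SubsetsOfSize n r U)
J n r = tokenGraph n r U

{-# OPTIONS --safe #-}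

-- Let φ : TJ k H ≅ J(n,r) with 2 ≤ r ≤ n - 2. A triangle of k-sets either has a
-- common (k-1)-subset (a star) or lies in a (k+1)-set X (a top). If a triangle
-- of TJ k H is a top, then X is a clique of H, since every pair of points of X
-- lies in one of the three sets; so the vertices equal or adjacent to all three
-- are the k + 1 subsets X - x. In J(n,r) a top has r + 1 such vertices and a
-- star n - r + 1 (complementation turns stars into tops), so one top in TJ k H
-- forces k = r or k = n - r. A top exists: if all triangles on an edge A, B were
-- stars, then any two common neighbours of A and B would share A ∩ B and so be
-- equal or adjacent, which fails in J(n,r).
--
-- For s = 1, an edgeless graph realises J(n,1) with k = 1, and coning over a
-- graph without (k+1)-cliques raises k by one.
module Submission where

open import Defs
open import Algebra.Lattice.Properties.BooleanAlgebra using (¬-involutive)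
open import Data.Empty using (⊥; ⊥-elim-irr)
open import Data.Fin using (Fin; zero; suc)
import Data.Fin.Properties as Fin
open import Data.Fin.Subset as Subset
  using (Subset; Nonempty; inside; outside; _∈_; _∉_; _⊆_; _∩_; ∁; _-_; ⁅_⁆; ∣_∣)
open import Data.Fin.Subset.Properties as Subset
  using (_∈?_; nonempty?; ⊆-antisym; p⊆q⇒∣p∣≤∣q∣; p⊂q⇒∣p∣<∣q∣; p∩q⊆p; p∩q⊆q;
         x∈p∩q⁺; x∈p∪q⁺; x∈p∪q⁻; p⊆p∪q; q⊆p∪q; x∈p∧x≢y⇒x∈p-y; p─q⊆p; p─⊥≡p;
         ∩-idem; ∣∁p∣≡n∸∣p∣; x∉p⇒x∈∁p; x∈∁p⇒x∉p; ∪-∩-booleanAlgebra)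
open import Data.Irrelevant using ([_])
open import Data.Nat using (ℕ; zero; suc; _+_; _*_; _∸_; _⊓_; _≤_; _<_; z≤n; s≤s)
open import Data.Nat.Properties
open import Data.Product using (∃-syntax; Σ-syntax; _×_; _,_; proj₁; proj₂)
open import Data.Refinement using (value; _,_)
open import Data.Refinement.Properties using (value-injective)
open import Data.Sum using (_⊎_; inj₁; inj₂; [_,_]′; swap)
open import Data.Unit using (tt)
open import Data.Vec using (_∷_; []; here; there)
open import Function using (_∘_; _$_)
open import Function.Bundles using (Inverse; Equivalence; mk⇔; mk↔ₛ′)
open import Function.Construct.Composition using (_⇔-∘_)
open import Function.Properties.Inverse using (↔-sym; ↔-trans)
open import Level using (0ℓ)
open import Relation.Binary.PropositionalEquality
  using (_≡_; _≢_; refl; sym; trans; cong; cong₂; subst; subst₂; module ≡-Reasoning)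
open import Relation.Nullary using (¬_; Dec; yes; no; contradiction)
open import Relation.Nullary.Decidable using (recompute; ¬?)
open import Relation.Unary using (Pred; U; _≐_; _∪_; ｛_｝)

private
  variable
    m n k r : ℕ

-- Cardinalities of finite subsets

∣p-x∣ : ∀ {p : Subset n} {x} → x ∈ p → suc ∣ p - x ∣ ≡ ∣ p ∣
∣p-x∣ {p = inside ∷ p} here = cong (suc ∘ ∣_∣) (p─⊥≡p p)
∣p-x∣ {p = outside ∷ p} (there x∈p) = ∣p-x∣ x∈p
∣p-x∣ {p = inside ∷ p} (there x∈p) = cong suc (∣p-x∣ x∈p)

x∉p-x : ∀ (p : Subset n) x → x ∉ p - x
x∉p-x (_ ∷ p) (suc x) (there x∈) = x∉p-x p x x∈

p-x⊆p : ∀ (p : Subset n) x → p - x ⊆ p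
p-x⊆p p x = p─q⊆p p ⁅ x ⁆

⊆-or-missing : (p q : Subset n) → p ⊆ q ⊎ (∃[ x ] x ∈ p × x ∉ q)
⊆-or-missing p q with nonempty? (p ∩ ∁ q)
... | yes (x , x∈) = inj₂ (x , p∩q⊆p p (∁ q) x∈ , x∈∁p⇒x∉p (p∩q⊆q p (∁ q) x∈))
... | no empty = inj₁ p⊆q
  where
  p⊆q : p ⊆ q
  p⊆q {x} x∈p with x ∈? q
  ... | yes x∈q = x∈q
  ... | no x∉q = contradiction (x , x∈p∩q⁺ (x∈p , x∉p⇒x∈∁p x∉q)) empty

⊆∧∣≥∣⇒⊇ : {p q : Subset n} → p ⊆ q → ∣ q ∣ ≤ ∣ p ∣ → q ⊆ p
⊆∧∣≥∣⇒⊇ {p = p} p⊆q ∣q∣≤∣p∣ {x} x∈q with x ∈? p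
... | yes x∈p = x∈p
... | no x∉p = contradiction ∣q∣≤∣p∣ (<⇒≱ (p⊂q⇒∣p∣<∣q∣ (p⊆q , x , x∈q , x∉p)))

∣∪∣+∣∩∣ : (p q : Subset n) → ∣ p Subset.∪ q ∣ + ∣ p ∩ q ∣ ≡ ∣ p ∣ + ∣ q ∣
∣∪∣+∣∩∣ [] [] = refl
∣∪∣+∣∩∣ (outside ∷ p) (outside ∷ q) = ∣∪∣+∣∩∣ p q
∣∪∣+∣∩∣ (outside ∷ p) (inside ∷ q) = trans (cong suc (∣∪∣+∣∩∣ p q)) (sym (+-suc ∣ p ∣ ∣ q ∣))
∣∪∣+∣∩∣ (inside ∷ p) (outside ∷ q) = cong suc (∣∪∣+∣∩∣ p q)
∣∪∣+∣∩∣ (inside ∷ p) (inside ∷ q) = cong suc $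
  trans (+-suc _ _) (trans (cong suc (∣∪∣+∣∩∣ p q)) (sym (+-suc ∣ p ∣ ∣ q ∣)))

-- Inclusion-exclusion without subtraction, as `∁ p ∩ ∁ q` is the complement of the union.
∣∁∩∁∣ : (p q : Subset n) → ∣ p ∣ + ∣ q ∣ + ∣ ∁ p ∩ ∁ q ∣ ≡ n + ∣ p ∩ q ∣
∣∁∩∁∣ [] [] = refl
∣∁∩∁∣ (outside ∷ p) (outside ∷ q) = trans (+-suc _ _) (cong suc (∣∁∩∁∣ p q))
∣∁∩∁∣ (outside ∷ p) (inside ∷ q) =
  trans (cong (_+ ∣ ∁ p ∩ ∁ q ∣) (+-suc ∣ p ∣ ∣ q ∣)) (cong suc (∣∁∩∁∣ p q))
∣∁∩∁∣ (inside ∷ p) (outside ∷ q) = cong suc (∣∁∩∁∣ p q)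
∣∁∩∁∣ (inside ∷ p) (inside ∷ q) = cong suc $
  trans (cong (_+ ∣ ∁ p ∩ ∁ q ∣) (+-suc ∣ p ∣ ∣ q ∣))
        (trans (cong suc (∣∁∩∁∣ p q)) (sym (+-suc _ _)))

-- Induction on `p` deletes the partner of its first element from `q`; injectivity of `R` keeps the
-- other partners away from it. Being a relation, `R` needs partners only for points of `p`.
∣∣-injection : (p : Subset m) (q : Subset n) (R : Fin m → Fin n → Set) →
  (∀ {x} → x ∈ p → ∃[ y ] y ∈ q × R x y) →
  (∀ {x x′ y} → R x y → R x′ y → x ≡ x′) → ∣ p ∣ ≤ ∣ q ∣
∣∣-injection [] q R total inj = z≤n
∣∣-injection (outside ∷ p) q R total inj =
  ∣∣-injection p q (R ∘ suc) (total ∘ there) (λ a b → Fin.suc-injective (inj a b))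
∣∣-injection (inside ∷ p) q R total inj with total here
... | y , y∈q , R0y = subst (suc ∣ p ∣ ≤_) (∣p-x∣ y∈q) $ s≤s $
  ∣∣-injection p (q - y) (R ∘ suc) total′ (λ a b → Fin.suc-injective (inj a b))
  where
  total′ : ∀ {x} → x ∈ p → ∃[ z ] z ∈ q - y × R (suc x) z
  total′ x∈p with total (there x∈p)
  ... | z , z∈q , Rxz =
    z , x∈p∧x≢y⇒x∈p-y z∈q (λ { refl → contradiction (inj R0y Rxz) λ () }) , Rxz

-- Isomorphisms of graphs

≅-sym : ∀ {V W} {G : Graph V} {H : Graph W} → G ≅ H → H ≅ G
≅-sym {H = H} φ = record
  { bijection = ↔-sym bijection
  ; adj⇔ = λ u v → mk⇔
      (λ e → Equivalence.from (adj⇔ (from u) (from v))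
        (subst₂ (Adj H) (sym (strictlyInverseˡ u)) (sym (strictlyInverseˡ v)) e))
      (λ e → subst₂ (Adj H) (strictlyInverseˡ u) (strictlyInverseˡ v)
        (Equivalence.to (adj⇔ (from u) (from v)) e))
  }
  where open _≅_ φ; open Inverse bijection

≅-trans : ∀ {V W X} {G : Graph V} {H : Graph W} {I : Graph X} → G ≅ H → H ≅ I → G ≅ I
≅-trans φ ψ = record
  { bijection = ↔-trans (_≅_.bijection φ) (_≅_.bijection ψ)
  ; adj⇔ = λ u v → _≅_.adj⇔ ψ _ _ ⇔-∘ _≅_.adj⇔ φ u v
  }

to : ∀ {V W} {G : Graph V} {H : Graph W} → G ≅ H → V → W
to φ = Inverse.to (_≅_.bijection φ)

to-adj : ∀ {V W} {G : Graph V} {H : Graph W} (φ : G ≅ H) {u v} →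
  Adj G u v → Adj H (to φ u) (to φ v)
to-adj φ = Equivalence.to (_≅_.adj⇔ φ _ _)

to-sym : ∀ {V W} {G : Graph V} {H : Graph W} (φ : G ≅ H) v → to φ (to (≅-sym φ) v) ≡ v
to-sym φ = Inverse.strictlyInverseˡ (_≅_.bijection φ)

sym-to : ∀ {V W} {G : Graph V} {H : Graph W} (φ : G ≅ H) v → to (≅-sym φ) (to φ v) ≡ v
sym-to φ = Inverse.strictlyInverseʳ (_≅_.bijection φ)

to-injective : ∀ {V W} {G : Graph V} {H : Graph W} (φ : G ≅ H) {u v} →
  to φ u ≡ to φ v → u ≡ v
to-injective φ {u} {v} e =
  trans (sym (sym-to φ u)) (trans (cong (to (≅-sym φ)) e) (sym-to φ v))

𝒦TJ-≅ : ∀ {V W} {G : Graph V} {H : Graph W} → G ≅ H → 𝒦TJ G k → 𝒦TJ H k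
𝒦TJ-≅ φ (1≤k , m , F , ψ) = 1≤k , m , F , ≅-trans ψ φ

-- Isomorphisms preserve this reflexive closure, and in a token graph it amounts to the single
-- inequality `k ≤ suc ∣ A ∩ B ∣`.
Near : ∀ {V} → Graph V → V → V → Set
Near G u v = u ≡ v ⊎ Adj G u v

to-near : ∀ {V W} {G : Graph V} {H : Graph W} (φ : G ≅ H) {u v} →
  Near G u v → Near H (to φ u) (to φ v)
to-near φ = [ inj₁ ∘ cong (to φ) , inj₂ ∘ to-adj φ ]′

-- Near vertices and top triangles in token graphs

module _ {P : Pred (Subset m) 0ℓ} where

  near⇒∣∩∣ : (A B : SubsetsOfSize m k P) → Near (tokenGraph m k P) A B →
    k ≤ suc ∣ value A ∩ value B ∣
  near⇒∣∩∣ A .A (inj₁ refl) =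
    m≤n⇒m≤1+n (≤-reflexive (trans (sym (size A)) (cong ∣_∣ (sym (∩-idem (value A))))))
  near⇒∣∩∣ A B (inj₂ e) = ≤-reflexive (sym e)

  ∣∩∣⇒near : (A B : SubsetsOfSize m k P) → k ≤ suc ∣ value A ∩ value B ∣ →
    Near (tokenGraph m k P) A B
  ∣∩∣⇒near {k = k} A B k≤ with m≤n⇒m<n∨m≡n k≤
  ... | inj₂ e = inj₂ (sym e)
  -- An intersection with at least `k` elements fills both `k`-sets.
  ... | inj₁ (s≤s k≤∣∩∣) = inj₁ (value-injective (⊆-antisym
          (p∩q⊆q (value A) (value B) ∘
            ⊆∧∣≥∣⇒⊇ (p∩q⊆p (value A) (value B)) (≤-trans (≤-reflexive (size A)) k≤∣∩∣))
          (p∩q⊆p (value A) (value B) ∘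
            ⊆∧∣≥∣⇒⊇ (p∩q⊆q (value A) (value B)) (≤-trans (≤-reflexive (size B)) k≤∣∩∣))))

-- At most one point of `D` lies outside `A`, and `y` already is one.
swap-⊆ : {D A : Subset n} → ∣ D ∣ ≤ suc ∣ D ∩ A ∣ → ∀ {y} → y ∈ D → y ∉ A → D - y ⊆ A
swap-⊆ {D = D} {A} ∣D∣≤ {y} y∈D y∉A =
  p∩q⊆q D A ∘ ⊆∧∣≥∣⇒⊇ D∩A⊆D-y (≤-pred (≤-trans (≤-reflexive (∣p-x∣ y∈D)) ∣D∣≤))
  where
  D∩A⊆D-y : D ∩ A ⊆ D - y
  D∩A⊆D-y z∈ = x∈p∧x≢y⇒x∈p-y (p∩q⊆p D A z∈) (λ { refl → y∉A (p∩q⊆q D A z∈) })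

module _ {P : Pred (Subset m) 0ℓ} where

  private
    G : ∀ k → Graph (SubsetsOfSize m k P)
    G k = tokenGraph m k P

  -- The witness x excludes a star, whose sets all contain A ∩ B.
  record Top (A B C : SubsetsOfSize m k P) : Set where
    field
      A~B : Adj (G k) A B
      C~A : Adj (G k) C A
      C~B : Adj (G k) C B
      x   : Fin m
      x∈A : x ∈ value A
      x∈B : x ∈ value B
      x∉C : x ∉ value C

  Top-resp-≡ : ∀ {A A′ B B′ C C′ : SubsetsOfSize m k P} →
    A ≡ A′ → B ≡ B′ → C ≡ C′ → Top A B C → Top A′ B′ C′
  Top-resp-≡ refl refl refl top = top

  module TopProperties {A B C : SubsetsOfSize m k P} (top : Top A B C) where
    open Top top

    private
      near-≤ : ∀ D E → Near (G k) D E → ∣ value D ∣ ≤ suc ∣ value D ∩ value E ∣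
      near-≤ D E D~E = subst (_≤ suc ∣ value D ∩ value E ∣) (sym (size D)) (near⇒∣∩∣ D E D~E)

    -- Two of the sets suffice: `C⊆∪` puts the third inside.
    ∪ABC : Subset m
    ∪ABC = value A Subset.∪ value B

    ∣∪ABC∣ : ∣ ∪ABC ∣ ≡ suc k
    ∣∪ABC∣ = +-cancelʳ-≡ ∣ value A ∩ value B ∣ _ _ (begin
      ∣ ∪ABC ∣ + ∣ value A ∩ value B ∣   ≡⟨ ∣∪∣+∣∩∣ (value A) (value B) ⟩
      ∣ value A ∣ + ∣ value B ∣          ≡⟨ cong₂ _+_ (size A) (size B) ⟩
      k + k                              ≡⟨ cong (k +_) A~B ⟨
      k + suc ∣ value A ∩ value B ∣      ≡⟨ +-suc k _ ⟩
      suc k + ∣ value A ∩ value B ∣      ∎)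
      where open ≡-Reasoning

    -- By `swap-⊆`, `D - y` lies in `A ∩ B`; both have `k - 1` elements, so they coincide.
    ∩⊆-outside : ∀ D {y} → Near (G k) D A → Near (G k) D B →
      y ∈ value D → y ∉ value A → y ∉ value B → value A ∩ value B ⊆ value D - y
    ∩⊆-outside D {y} D~A D~B y∈D y∉A y∉B = ⊆∧∣≥∣⇒⊇
      (λ z∈ → x∈p∩q⁺ (swap-⊆ (near-≤ D A D~A) y∈D y∉A z∈ ,
                      swap-⊆ (near-≤ D B D~B) y∈D y∉B z∈))
      (≤-reflexive (suc-injective (trans A~B (trans (sym (size D)) (sym (∣p-x∣ y∈D))))))

    near⇒⊆∪ : ∀ D → Near (G k) D A → Near (G k) D B → Near (G k) D C → value D ⊆ ∪ABC
    near⇒⊆∪ D D~A D~B D~C {y} y∈D with y ∈? value A | y ∈? value B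
    ... | yes y∈A | _ = x∈p∪q⁺ (inj₁ y∈A)
    ... | no _ | yes y∈B = x∈p∪q⁺ (inj₂ y∈B)
    -- Here `D` would be `A ∩ B` plus `y`. If `y ∈ C`, the same argument for `C` puts `x` into `C`;
    -- otherwise `D - y`, which contains `x`, lies in `C`.
    ... | no y∉A | no y∉B = contradiction
        (swap-⊆ (near-≤ D C D~C) y∈D y∉C (∩⊆-outside D D~A D~B y∈D y∉A y∉B x∈A∩B)) x∉C
      where
      x∈A∩B : x ∈ value A ∩ value B
      x∈A∩B = x∈p∩q⁺ (x∈A , x∈B)
      y∉C : y ∉ value C
      y∉C y∈C = x∉C (p-x⊆p (value C) y
        (∩⊆-outside C (inj₂ C~A) (inj₂ C~B) y∈C y∉A y∉B x∈A∩B))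

    C⊆∪ : value C ⊆ ∪ABC
    C⊆∪ = near⇒⊆∪ C (inj₂ C~A) (inj₂ C~B) (inj₁ refl)

    -- Inclusion-exclusion for two `k`-sets inside a set of `k + 1` points.
    ⊆∪⇒near : ∀ D E → value D ⊆ ∪ABC → value E ⊆ ∪ABC → Near (G k) D E
    ⊆∪⇒near D E D⊆ E⊆ = ∣∩∣⇒near D E (+-cancelˡ-≤ k _ _ (begin
      k + k                           ≡⟨ cong₂ _+_ (size D) (size E) ⟨
      ∣ value D ∣ + ∣ value E ∣       ≡⟨ ∣∪∣+∣∩∣ (value D) (value E) ⟨
      ∣ value D Subset.∪ value E ∣ + ∣D∩E∣
        ≤⟨ +-monoˡ-≤ ∣D∩E∣ (p⊆q⇒∣p∣≤∣q∣ ([ D⊆ , E⊆ ]′ ∘ x∈p∪q⁻ (value D) (value E))) ⟩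
      ∣ ∪ABC ∣ + ∣D∩E∣                ≡⟨ cong (_+ ∣D∩E∣) ∣∪ABC∣ ⟩
      suc k + ∣D∩E∣                   ≡⟨ +-suc k ∣D∩E∣ ⟨
      k + suc ∣D∩E∣                   ∎))
      where
      open ≤-Reasoning
      ∣D∩E∣ = ∣ value D ∩ value E ∣

    A∖x⊆C : ∀ {u} → u ∈ value A → u ≢ x → u ∈ value C
    A∖x⊆C u∈A u≢x = swap-⊆ (near-≤ A C (inj₂ (symm (G k) {C} {A} C~A))) x∈A x∉C
      (x∈p∧x≢y⇒x∈p-y u∈A u≢x)

    B∖x⊆C : ∀ {u} → u ∈ value B → u ≢ x → u ∈ value C
    B∖x⊆C u∈B u≢x = swap-⊆ (near-≤ B C (inj₂ (symm (G k) {C} {B} C~B))) x∈B x∉C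
      (x∈p∧x≢y⇒x∈p-y u∈B u≢x)

    -- Since `D` is a vertex, this makes the union a clique when `P` asks for pairwise adjacency.
    covers-pairs : ∀ {u v} → u ∈ ∪ABC → v ∈ ∪ABC →
      ∃[ D ] u ∈ value D × v ∈ value D
    covers-pairs {u} {v} u∈ v∈ with u ∈? value A | v ∈? value A | u ∈? value B | v ∈? value B
    ... | yes u∈A | yes v∈A | _ | _ = A , u∈A , v∈A
    ... | _ | _ | yes u∈B | yes v∈B = B , u∈B , v∈B
    ... | no u∉A | _ | no u∉B | _ = contradiction (x∈p∪q⁻ (value A) (value B) u∈) [ u∉A , u∉B ]′
    ... | _ | no v∉A | _ | no v∉B = contradiction (x∈p∪q⁻ (value A) (value B) v∈) [ v∉A , v∉B ]′
    -- A point of only one of `A` and `B` differs from `x`, which is in both, and `x` is all that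
    -- `C` omits of either.
    ... | yes u∈A | no v∉A | no u∉B | yes v∈B =
      C , A∖x⊆C u∈A (λ { refl → u∉B x∈B }) , B∖x⊆C v∈B (λ { refl → v∉A x∈A })
    ... | no u∉A | yes v∈A | yes u∈B | no v∉B =
      C , B∖x⊆C u∈B (λ { refl → u∉A x∈A }) , A∖x⊆C v∈A (λ { refl → v∉B x∈B })

-- Comparing ranks through a top

module _ {P : Pred (Subset m) 0ℓ} {Q : Pred (Subset n) 0ℓ}
  (φ : tokenGraph m k P ≅ tokenGraph n r Q)
  {A B C : SubsetsOfSize m k P} (top : Top A B C)
  (topφ : Top (to φ A) (to φ B) (to φ C))
  (closed : ∀ {D} → D ⊆ TopProperties.∪ABC top → P D)
  where

  private
    module T = TopProperties top
    module T′ = TopProperties topφ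

    co-singleton : ∀ {x} → x ∈ T.∪ABC → SubsetsOfSize m k P
    co-singleton {x} x∈ = T.∪ABC - x ,
      [ suc-injective (trans (∣p-x∣ x∈) T.∣∪ABC∣) , closed (p-x⊆p T.∪ABC x) ]

    -- The set omitting `x` is near each of `A`, `B`, `C`, and `φ` preserves this, so `near⇒⊆∪`
    -- applies to the image triangle.
    image-⊆ : ∀ {x} (x∈ : x ∈ T.∪ABC) → value (to φ (co-singleton x∈)) ⊆ T′.∪ABC
    image-⊆ {x} x∈ = T′.near⇒⊆∪ (to φ V)
      (to-near φ (T.⊆∪⇒near V A V⊆ (p⊆p∪q (value B))))
      (to-near φ (T.⊆∪⇒near V B V⊆ (q⊆p∪q (value A) (value B))))
      (to-near φ (T.⊆∪⇒near V C V⊆ T.C⊆∪))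
      where
      V = co-singleton x∈
      V⊆ : value V ⊆ T.∪ABC
      V⊆ = p-x⊆p T.∪ABC x

    -- The image of `∪ABC - x` is the image union without `y`. The membership proof is stored
    -- because `co-singleton` takes it as an argument.
    Misses : Fin m → Fin n → Set
    Misses x y = Σ[ x∈ ∈ x ∈ T.∪ABC ] value (to φ (co-singleton x∈)) ≡ T′.∪ABC - y

    misses-total : ∀ {x} → x ∈ T.∪ABC → ∃[ y ] y ∈ T′.∪ABC × Misses x y
    misses-total x∈ with ⊆-or-missing T′.∪ABC (value (to φ (co-singleton x∈)))
    ... | inj₁ ⊆V = contradiction (p⊆q⇒∣p∣≤∣q∣ ⊆V)
          (<⇒≱ (≤-reflexive (trans (cong suc (size (to φ (co-singleton x∈)))) (sym T′.∣∪ABC∣))))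
    ... | inj₂ (y , y∈ , y∉V) = y , y∈ , x∈ , ⊆-antisym V⊆ (⊆∧∣≥∣⇒⊇ V⊆ (≤-reflexive
          (suc-injective (trans (∣p-x∣ y∈) (trans T′.∣∪ABC∣ (cong suc (sym (size (to φ (co-singleton x∈))))))))))
      where
      V⊆ : value (to φ (co-singleton x∈)) ⊆ T′.∪ABC - y
      V⊆ z∈V = x∈p∧x≢y⇒x∈p-y (image-⊆ x∈ z∈V) (λ { refl → y∉V z∈V })

    -- Equal images have equal preimages, but for `x ≢ x′` only `∪ABC - x′` contains `x`.
    misses-injective : ∀ {x x′ y} → Misses x y → Misses x′ y → x ≡ x′
    misses-injective {x} {x′} (x∈ , e) (x′∈ , e′) with x Fin.≟ x′
    ... | yes x≡x′ = x≡x′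
    ... | no x≢x′ = contradiction
        (subst (x ∈_) (sym (cong value V≡V′)) (x∈p∧x≢y⇒x∈p-y x∈ x≢x′)) (x∉p-x T.∪ABC x)
      where
      V≡V′ : co-singleton x∈ ≡ co-singleton x′∈
      V≡V′ = to-injective φ (value-injective (trans e (sym e′)))

  -- `Misses` matches the `k + 1` points of one union injectively with the `r + 1` points of the
  -- other. General `P` and `Q` allow the use of both an isomorphism and its inverse.
  top⇒rank-≤ : k ≤ r
  top⇒rank-≤ = ≤-pred (subst₂ _≤_ T.∣∪ABC∣ T′.∣∪ABC∣
    (∣∣-injection T.∪ABC T′.∪ABC Misses misses-total misses-injective))

module _ {H : Graph (Fin m)} (φ : TJ k H ≅ J n r)
  {A B C : Clique k H} (top : Top A B C) (topφ : Top (to φ A) (to φ B) (to φ C)) where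

  private
    module T = TopProperties top

    ∪-clique : PairwiseAdjacent H T.∪ABC
    ∪-clique u v u∈ v∈ u≢v with T.covers-pairs u∈ v∈
    -- The clique proof of `D` is irrelevant; decidable adjacency recovers a relevant one.
    ... | (_ , [ p ]) , u∈D , v∈D = recompute (adj? H u v) (proj₂ p u v u∈D v∈D u≢v)

    topφ⁻¹φ : Top (to (≅-sym φ) (to φ A)) (to (≅-sym φ) (to φ B)) (to (≅-sym φ) (to φ C))
    topφ⁻¹φ = Top-resp-≡ (sym (sym-to φ A)) (sym (sym-to φ B)) (sym (sym-to φ C)) top

  top⇒rank-≡ : k ≡ r
  top⇒rank-≡ = ≤-antisym
    (top⇒rank-≤ φ top topφ (λ D⊆ u v u∈ v∈ → ∪-clique u v (D⊆ u∈) (D⊆ v∈)))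
    -- All `r`-subsets are vertices of `J n r`, so closure is trivial in this direction.
    (top⇒rank-≤ (≅-sym φ) topφ topφ⁻¹φ (λ _ → tt))

-- Complementation of Johnson graphs

∁-involutive : (p : Subset n) → ∁ (∁ p) ≡ p
∁-involutive {n} = ¬-involutive (∪-∩-booleanAlgebra n)

-- With `c` and `c′` the intersection sizes before and after complementing, `count` gives
-- `r + c′ ≡ (n ∸ r) + c`, so `suc c ≡ r` exactly when `suc c′ ≡ n ∸ r`.
J-∁ : r ≤ n → J n r ≅ J n (n ∸ r)
J-∁ {r} {n} r≤n = record
  { bijection = mk↔ₛ′ ∁-to ∁-from
      (λ A → value-injective (∁-involutive (value A)))
      (λ A → value-injective (∁-involutive (value A)))
  ; adj⇔ = λ A B → mk⇔
      (λ e → +-cancelˡ-≡ ∣ value A ∩ value B ∣ _ _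
        (trans (+-suc _ _) (trans (cong (_+ ∣ ∁ (value A) ∩ ∁ (value B) ∣) e)
          (trans (count A B) (+-comm (n ∸ r) _)))))
      (λ e → +-cancelʳ-≡ ∣ ∁ (value A) ∩ ∁ (value B) ∣ _ _
        (sym (trans (count A B) (trans (cong (_+ ∣ value A ∩ value B ∣) (sym e))
          (cong suc (+-comm ∣ ∁ (value A) ∩ ∁ (value B) ∣ _))))))
  }
  where
  ∁-to : SubsetsOfSize n r U → SubsetsOfSize n (n ∸ r) U
  ∁-to A = ∁ (value A) , [ trans (∣∁p∣≡n∸∣p∣ (value A)) (cong (n ∸_) (size A)) , tt ]
  ∁-from : SubsetsOfSize n (n ∸ r) U → SubsetsOfSize n r U
  ∁-from A = ∁ (value A) ,
    [ trans (∣∁p∣≡n∸∣p∣ (value A)) (trans (cong (n ∸_) (size A)) (m∸[m∸n]≡n r≤n)) , tt ]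
  count : ∀ (A B : SubsetsOfSize n r U) →
    r + ∣ ∁ (value A) ∩ ∁ (value B) ∣ ≡ (n ∸ r) + ∣ value A ∩ value B ∣
  count A B = +-cancelˡ-≡ r _ _ (begin
    r + (r + c′)                           ≡⟨ +-assoc r r c′ ⟨
    r + r + c′                             ≡⟨ cong₂ (λ a b → a + b + c′) (size A) (size B) ⟨
    ∣ value A ∣ + ∣ value B ∣ + c′         ≡⟨ ∣∁∩∁∣ (value A) (value B) ⟩
    n + c                                  ≡⟨ cong (_+ c) (m+[n∸m]≡n r≤n) ⟨
    r + (n ∸ r) + c                        ≡⟨ +-assoc r (n ∸ r) c ⟩
    r + (n ∸ r + c)                        ∎)
    where
    open ≡-Reasoning
    c = ∣ value A ∩ value B ∣
    c′ = ∣ ∁ (value A) ∩ ∁ (value B) ∣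

-- The possible ranks of a realisation of J(n,r)

subset-of-size : ∀ a b → Σ[ p ∈ Subset (a + b) ] ∣ p ∣ ≡ a
subset-of-size zero b = Subset.⊥ , Subset.∣⊥∣≡0 b
subset-of-size (suc a) b with subset-of-size a b
... | p , ∣p∣≡a = inside ∷ p , cong suc ∣p∣≡a

-- In J(n,r) the triangle ABC below is a star and ABD is a top; their preimages
-- are not both stars.
rank-of-J : ∀ a b {H : Graph (Fin m)} → TJ k H ≅ J (4 + (a + b)) (2 + a) →
  k ≡ 2 + a ⊎ k ≡ 4 + (a + b) ∸ (2 + a)
rank-of-J {m} {k} a b {H} φ = cases (⊆-or-missing
    (value (φ⁻¹ A) ∩ value (φ⁻¹ B)) (value (φ⁻¹ C) ∩ value (φ⁻¹ D)))
  where
  N = 4 + (a + b)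
  R = proj₁ (subset-of-size a b)
  ∣R∣≡a = proj₂ (subset-of-size a b)
  ∣R∩R∣≡a : ∣ R ∩ R ∣ ≡ a
  ∣R∩R∣≡a = trans (cong ∣_∣ (∩-idem R)) ∣R∣≡a

  -- Besides `R` these are the pairs 02, 03, 01, 23 of the first four points: `A`, `B`, `C` share 0;
  -- `A`, `B`, `D` lie in `R` plus 0, 2, 3; `C` and `D` meet only in `R`.
  A B C D : SubsetsOfSize N (2 + a) U
  A = inside ∷ outside ∷ inside ∷ outside ∷ R , [ cong (2 +_) ∣R∣≡a , tt ]
  B = inside ∷ outside ∷ outside ∷ inside ∷ R , [ cong (2 +_) ∣R∣≡a , tt ]
  C = inside ∷ inside ∷ outside ∷ outside ∷ R , [ cong (2 +_) ∣R∣≡a , tt ]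
  D = outside ∷ outside ∷ inside ∷ inside ∷ R , [ cong (2 +_) ∣R∣≡a , tt ]

  A~B : Adj (J N (2 + a)) A B
  A~B = cong (2 +_) ∣R∩R∣≡a
  C~A : Adj (J N (2 + a)) C A
  C~A = cong (2 +_) ∣R∩R∣≡a
  C~B : Adj (J N (2 + a)) C B
  C~B = cong (2 +_) ∣R∩R∣≡a
  D~A : Adj (J N (2 + a)) D A
  D~A = cong (2 +_) ∣R∩R∣≡a
  D~B : Adj (J N (2 + a)) D B
  D~B = cong (2 +_) ∣R∩R∣≡a
  C≁D : ¬ Near (J N (2 + a)) C D
  C≁D C~D = 1+n≰n (subst (λ c → 2 + a ≤ suc c) ∣R∩R∣≡a (near⇒∣∩∣ C D C~D))

  φ⁻¹ : SubsetsOfSize N (2 + a) U → Clique k H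
  φ⁻¹ = to (≅-sym φ)
  φ⁻¹-adj : ∀ {X Y} → Adj (J N (2 + a)) X Y → Adj (TJ k H) (φ⁻¹ X) (φ⁻¹ Y)
  φ⁻¹-adj {X} {Y} = to-adj (≅-sym φ) {X} {Y}

  θ : J N (2 + a) ≅ J N (N ∸ (2 + a))
  θ = J-∁ (+-monoʳ-≤ 2 (m≤n⇒m≤o+n 2 (m≤m+n a b)))
  ψ : TJ k H ≅ J N (N ∸ (2 + a))
  ψ = ≅-trans φ θ

  θ-to-sym : ∀ X → to θ X ≡ to θ (to φ (φ⁻¹ X))
  θ-to-sym X = cong (to θ) (sym (to-sym φ X))

  cases : value (φ⁻¹ A) ∩ value (φ⁻¹ B) ⊆ value (φ⁻¹ C) ∩ value (φ⁻¹ D) ⊎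
    (∃[ x ] x ∈ value (φ⁻¹ A) ∩ value (φ⁻¹ B) × x ∉ value (φ⁻¹ C) ∩ value (φ⁻¹ D)) →
    k ≡ 2 + a ⊎ k ≡ N ∸ (2 + a)
  -- The preimages of `C` and `D` would share `k - 1` points and hence be near.
  cases (inj₁ ∩⊆) = contradiction
    (subst₂ (Near (J N (2 + a))) (to-sym φ C) (to-sym φ D) (to-near φ
      (∣∩∣⇒near (φ⁻¹ C) (φ⁻¹ D)
        (≤-trans (≤-reflexive (sym (φ⁻¹-adj {A} {B} A~B))) (s≤s (p⊆q⇒∣p∣≤∣q∣ ∩⊆))))))
    C≁D
  cases (inj₂ (x , x∈A∩B , x∉C∩D)) with x ∈? value (φ⁻¹ C)
  -- Then the preimage of `D` omits `x`, and the triangle `A`, `B`, `D` is a top on both sides of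
  -- `φ`.
  ... | yes x∈C = inj₁ (top⇒rank-≡ {H = H} φ ABD
        (Top-resp-≡ (sym (to-sym φ A)) (sym (to-sym φ B)) (sym (to-sym φ D)) ABD′))
    where
    ABD : Top (φ⁻¹ A) (φ⁻¹ B) (φ⁻¹ D)
    ABD = record
      { A~B = φ⁻¹-adj {A} {B} A~B ; C~A = φ⁻¹-adj {D} {A} D~A ; C~B = φ⁻¹-adj {D} {B} D~B
      ; x∈A = p∩q⊆p (value (φ⁻¹ A)) _ x∈A∩B ; x∈B = p∩q⊆q _ (value (φ⁻¹ B)) x∈A∩B
      ; x∉C = λ x∈D → x∉C∩D (x∈p∩q⁺ (x∈C , x∈D)) }
    ABD′ : Top A B D
    ABD′ = record
      { A~B = A~B ; C~A = D~A ; C~B = D~B ; x = zero ; x∈A = here ; x∈B = here ; x∉C = λ () }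
  -- The preimages of `A`, `B`, `C` form a top, but these sets themselves a star; `θ` turns the star
  -- into a top, of rank `N ∸ (2 + a)`.
  ... | no x∉C = inj₂ (top⇒rank-≡ {H = H} ψ ABC
        (Top-resp-≡ (θ-to-sym A) (θ-to-sym B) (θ-to-sym C) ABC′))
    where
    ABC : Top (φ⁻¹ A) (φ⁻¹ B) (φ⁻¹ C)
    ABC = record
      { A~B = φ⁻¹-adj {A} {B} A~B ; C~A = φ⁻¹-adj {C} {A} C~A ; C~B = φ⁻¹-adj {C} {B} C~B
      ; x∈A = p∩q⊆p (value (φ⁻¹ A)) _ x∈A∩B ; x∈B = p∩q⊆q _ (value (φ⁻¹ B)) x∈A∩B
      ; x∉C = x∉C }
    ABC′ : Top (to θ A) (to θ B) (to θ C)
    ABC′ = record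
      { A~B = to-adj θ {A} {B} A~B ; C~A = to-adj θ {C} {A} C~A ; C~B = to-adj θ {C} {B} C~B
      -- Of `A`, `B`, `C` only `C` contains point 1, so only its complement omits it.
      ; x = suc zero ; x∈A = there here ; x∈B = there here ; x∉C = λ { (there ()) } }

-- Realisations by complete graphs and iterated cones

complete : ∀ m → Graph (Fin m)
complete m = record
  { Adj = _≢_ ; adj? = λ u v → ¬? (u Fin.≟ v)
  ; symm = λ u≢v → u≢v ∘ sym ; irrefl = λ u≡v u≢v → u≢v u≡v }

TJ-complete : ∀ n r → TJ r (complete n) ≅ J n r
TJ-complete n r = record
  { bijection = mk↔ₛ′
      (λ { (A , [ p ]) → A , [ proj₁ p , tt ] })
      (λ { (A , [ p ]) → A , [ proj₁ p , (λ _ _ _ _ u≢v → u≢v) ] })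
      (λ _ → refl) (λ _ → refl)
  ; adj⇔ = λ _ _ → mk⇔ (λ e → e) (λ e → e)
  }

edgeless : ∀ m → Graph (Fin m)
edgeless m = record
  { Adj = λ _ _ → ⊥ ; adj? = λ _ _ → no λ () ; symm = λ () ; irrefl = λ _ () }

∣p∣≡1⇒unique : {p : Subset n} → ∣ p ∣ ≡ 1 → ∀ {u v} → u ∈ p → v ∈ p → u ≡ v
∣p∣≡1⇒unique {p = p} ∣p∣≡1 {u} {v} u∈p v∈p with u Fin.≟ v
... | yes u≡v = u≡v
... | no u≢v = contradiction
  (trans (∣p-x∣ (x∈p∧x≢y⇒x∈p-y u∈p u≢v)) (suc-injective (trans (∣p-x∣ v∈p) ∣p∣≡1))) λ ()

∣p∣≡1+k⇒nonempty : {p : Subset n} → ∣ p ∣ ≡ suc k → Nonempty p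
∣p∣≡1+k⇒nonempty {n} {p = p} ∣p∣≡1+k with nonempty? p
... | yes ne = ne
... | no empty = contradiction
  (trans (sym ∣p∣≡1+k) (trans (cong ∣_∣ (Subset.Empty-unique empty)) (Subset.∣⊥∣≡0 n))) λ ()

∣p∣≡2⇒distinct : {p : Subset n} → ∣ p ∣ ≡ 2 → ∃[ u ] ∃[ v ] u ∈ p × v ∈ p × u ≢ v
∣p∣≡2⇒distinct {p = p} ∣p∣≡2 with ∣p∣≡1+k⇒nonempty ∣p∣≡2
... | u , u∈p with ∣p∣≡1+k⇒nonempty (suc-injective (trans (∣p-x∣ u∈p) ∣p∣≡2))
... | v , v∈p-u = u , v , u∈p , p-x⊆p p u v∈p-u , λ { refl → x∉p-x p u v∈p-u }

TJ-edgeless : ∀ n → TJ 1 (edgeless n) ≅ J n 1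
TJ-edgeless n = record
  { bijection = mk↔ₛ′
      (λ { (A , [ p ]) → A , [ proj₁ p , tt ] })
      (λ { (A , [ p ]) → A ,
        [ proj₁ p , (λ _ _ u∈ v∈ u≢v → u≢v (∣p∣≡1⇒unique (proj₁ p) u∈ v∈)) ] })
      (λ _ → refl) (λ _ → refl)
  ; adj⇔ = λ _ _ → mk⇔ (λ e → e) (λ e → e)
  }

data ConeAdj (H : Graph (Fin m)) : Fin (suc m) → Fin (suc m) → Set where
  apexˡ : ∀ {v} → ConeAdj H zero (suc v)
  apexʳ : ∀ {u} → ConeAdj H (suc u) zero
  base  : ∀ {u v} → Adj H u v → ConeAdj H (suc u) (suc v)

cone : Graph (Fin m) → Graph (Fin (suc m))
cone H = record { Adj = ConeAdj H ; adj? = dec ; symm = csym ; irrefl = cirrefl }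
  where
  dec : ∀ u v → Dec (ConeAdj H u v)
  dec zero zero = no λ ()
  dec zero (suc v) = yes apexˡ
  dec (suc u) zero = yes apexʳ
  dec (suc u) (suc v) with adj? H u v
  ... | yes e = yes (base e)
  ... | no ¬e = no λ { (base e) → ¬e e }
  csym : ∀ {u v} → ConeAdj H u v → ConeAdj H v u
  csym apexˡ = apexʳ
  csym apexʳ = apexˡ
  csym (base e) = base (symm H e)
  cirrefl : ∀ {u v} → u ≡ v → ¬ ConeAdj H u v
  cirrefl refl (base e) = irrefl H refl e

module _ {H : Graph (Fin m)} where

  cone-clique⁺ : ∀ {A} → PairwiseAdjacent H A → PairwiseAdjacent (cone H) (inside ∷ A)
  cone-clique⁺ cl zero zero _ _ 0≢0 = contradiction refl 0≢0
  cone-clique⁺ cl zero (suc v) _ _ _ = apexˡ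
  cone-clique⁺ cl (suc u) zero _ _ _ = apexʳ
  cone-clique⁺ cl (suc u) (suc v) (there u∈) (there v∈) u≢v =
    base (cl u v u∈ v∈ (u≢v ∘ cong suc))

  cone-clique⁻ : ∀ {s A} → PairwiseAdjacent (cone H) (s ∷ A) → PairwiseAdjacent H A
  cone-clique⁻ cl u v u∈ v∈ u≢v
    with base e ← cl (suc u) (suc v) (there u∈) (there v∈) (u≢v ∘ Fin.suc-injective) = e

NoClique : ℕ → Graph (Fin m) → Set
NoClique k H = ∀ {A} → ∣ A ∣ ≡ k → ¬ PairwiseAdjacent H A

edgeless-NoClique : ∀ n → NoClique 2 (edgeless n)
edgeless-NoClique n ∣A∣≡2 cl with ∣p∣≡2⇒distinct ∣A∣≡2
... | u , v , u∈ , v∈ , u≢v = cl u v u∈ v∈ u≢v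

cone-NoClique : (H : Graph (Fin m)) → NoClique (suc k) H → NoClique (suc (suc k)) (cone H)
cone-NoClique H none {inside ∷ A} ∣A∣ cl = none (suc-injective ∣A∣) (cone-clique⁻ cl)
cone-NoClique {k = k} H none {outside ∷ A} ∣A∣ cl with ∣p∣≡1+k⇒nonempty {p = A} ∣A∣
-- A clique avoiding the apex lies in `H` with one vertex too many; dropping any vertex gives a
-- forbidden clique.
... | x , x∈A = none {A - x} (suc-injective (trans (∣p-x∣ {p = A} x∈A) ∣A∣))
      (λ u v u∈ v∈ → cone-clique⁻ cl u v (p-x⊆p A x u∈) (p-x⊆p A x v∈))

-- As `H` has no clique of `suc k` vertices, every clique of that size in the cone uses the apex;
-- deleting it lowers sizes and intersections by one.
TJ-cone : (H : Graph (Fin m)) → NoClique (suc k) H → TJ k H ≅ TJ (suc k) (cone H)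
TJ-cone {m} {k} H none = record
  { bijection = mk↔ₛ′ add remove add-remove (λ _ → refl)
  ; adj⇔ = λ _ _ → mk⇔ (cong suc) suc-injective
  }
  where
  add : Clique k H → Clique (suc k) (cone H)
  add (A , [ p ]) = inside ∷ A , [ cong suc (proj₁ p) , cone-clique⁺ (proj₂ p) ]
  remove : Clique (suc k) (cone H) → Clique k H
  remove (inside ∷ A , [ p ]) = A , [ suc-injective (proj₁ p) , cone-clique⁻ (proj₂ p) ]
  -- The contradiction comes from irrelevant proofs, hence `⊥-elim-irr`.
  remove (outside ∷ A , [ p ]) = ⊥-elim-irr (none (proj₁ p) (cone-clique⁻ (proj₂ p)))
  add-remove : ∀ A → add (remove A) ≡ A
  add-remove (inside ∷ A , _) = refl
  add-remove (outside ∷ A , [ p ]) = ⊥-elim-irr (none (proj₁ p) (cone-clique⁻ (proj₂ p)))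

-- `j` counts the cones taken over the edgeless graph. The absence of larger cliques is carried
-- along for the next cone.
cone-realisation : ∀ n j →
  ∃[ m ] Σ[ H ∈ Graph (Fin m) ] NoClique (2 + j) H × TJ (1 + j) H ≅ J n 1
cone-realisation n zero = n , edgeless n , edgeless-NoClique n , TJ-edgeless n
cone-realisation n (suc j) with cone-realisation n j
... | m , H , none , φ =
  suc m , cone H , cone-NoClique H none , ≅-trans (≅-sym (TJ-cone H none)) φ

𝒦TJ-J1 : 1 ≤ k → 𝒦TJ (J n 1) k
𝒦TJ-J1 {suc j} {n} 1≤k with cone-realisation n j
... | m , H , _ , φ = 1≤k , m , H , φ

-- Assembling the three cases

𝒦TJ-J : 2 ≤ r → 2 ≤ n ∸ r → r ≤ n → 𝒦TJ (J n r) ≐ (｛ r ｝ ∪ ｛ n ∸ r ｝)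
𝒦TJ-J {r} {n} 2≤r 2≤n∸r r≤n = ⊆-part , ⊇-part
  where
  -- This brings `r` and `n ∸ r` into the forms `2 + a` and `2 + b` expected by `rank-of-J`.
  a = r ∸ 2
  b = n ∸ r ∸ 2
  r≡ : 2 + a ≡ r
  r≡ = m+[n∸m]≡n 2≤r
  n≡ : 4 + (a + b) ≡ n
  n≡ = begin
    4 + (a + b)        ≡⟨ cong (2 +_) (+-assoc 2 a b) ⟨
    2 + (2 + a + b)    ≡⟨ cong (λ c → 2 + (c + b)) r≡ ⟩
    2 + (r + b)        ≡⟨ trans (+-suc r (suc b)) (cong suc (+-suc r b)) ⟨
    r + (2 + b)        ≡⟨ cong (r +_) (m+[n∸m]≡n 2≤n∸r) ⟩
    r + (n ∸ r)        ≡⟨ m+[n∸m]≡n r≤n ⟩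
    n                  ∎
    where open ≡-Reasoning
  ⊆-part : ∀ {k} → 𝒦TJ (J n r) k → r ≡ k ⊎ n ∸ r ≡ k
  ⊆-part {k} (_ , m , H , φ) = [ inj₁ ∘ sym , inj₂ ∘ sym ]′
    (subst₂ (λ n r → TJ k H ≅ J n r → k ≡ r ⊎ k ≡ n ∸ r) n≡ r≡ (rank-of-J a b {H}) φ)
  ⊇-part : ∀ {k} → r ≡ k ⊎ n ∸ r ≡ k → 𝒦TJ (J n r) k
  ⊇-part (inj₁ refl) = ≤-trans (s≤s z≤n) 2≤r , n , complete n , TJ-complete n r
  -- The complete graph realises `J n (n ∸ r)`, which complementation identifies with `J n r`.
  ⊇-part (inj₂ refl) = ≤-trans (s≤s z≤n) 2≤n∸r , n , complete n ,
    ≅-trans (TJ-complete n (n ∸ r)) (≅-sym (J-∁ r≤n))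

-- If the minimum is `n ∸ r`, subtracting it from `n` returns `r`, and only the order of the pair
-- changes.
⊓-pair : r ≤ n → (｛ r ｝ ∪ ｛ n ∸ r ｝) ≐ (｛ r ⊓ (n ∸ r) ｝ ∪ ｛ n ∸ (r ⊓ (n ∸ r)) ｝)
⊓-pair {r} {n} r≤n with r ⊓ (n ∸ r) | ⊓-sel r (n ∸ r)
... | _ | inj₁ refl = (λ x → x) , (λ x → x)
... | _ | inj₂ refl rewrite m∸[m∸n]≡n r≤n = swap , swap

theorem4p14 : (n r : ℕ) → 2 ≤ n → 1 ≤ r → r ≤ n ∸ 1 →
    let s = r ⊓ (n ∸ r) in
    (s ≡ 1 → 𝒦TJ (J n r) ≐ (λ k → 1 ≤ k)) ×
    (2 ≤ s → n ≡ 2 * s → 𝒦TJ (J n r) ≐ ｛ s ｝) ×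
    (2 ≤ s → 2 * s < n → 𝒦TJ (J n r) ≐ (｛ s ｝ ∪ ｛ n ∸ s ｝))
theorem4p14 n r _ _ r≤n∸1 =
    (λ s≡1 → proj₁ , case₁ s≡1)
  , (λ 2≤s n≡2s → case₂ n≡2s (both 2≤s))
  , (λ 2≤s _ → both 2≤s)
  where
  s = r ⊓ (n ∸ r)
  r≤n : r ≤ n
  r≤n = ≤-trans r≤n∸1 (m∸n≤m n 1)

  case₁ : s ≡ 1 → ∀ {k} → 1 ≤ k → 𝒦TJ (J n r) k
  case₁ s≡1 {k} 1≤k with ⊓-sel r (n ∸ r)
  ... | inj₁ s≡r = subst (λ r → 𝒦TJ (J n r) k) (trans (sym s≡1) s≡r) (𝒦TJ-J1 1≤k)
  -- Here `n ∸ r` is 1, so complementation leads to rank one.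
  ... | inj₂ s≡n∸r = 𝒦TJ-≅ (≅-sym (J-∁ r≤n))
        (subst (λ r → 𝒦TJ (J n r) k) (trans (sym s≡1) s≡n∸r) (𝒦TJ-J1 1≤k))

  both : 2 ≤ s → 𝒦TJ (J n r) ≐ (｛ s ｝ ∪ ｛ n ∸ s ｝)
  both 2≤s = proj₁ (⊓-pair r≤n) ∘ proj₁ eq , proj₂ eq ∘ proj₂ (⊓-pair r≤n)
    where
    eq = 𝒦TJ-J (≤-trans 2≤s (m⊓n≤m r (n ∸ r))) (≤-trans 2≤s (m⊓n≤n r (n ∸ r))) r≤n

  case₂ : n ≡ 2 * s → 𝒦TJ (J n r) ≐ (｛ s ｝ ∪ ｛ n ∸ s ｝) → 𝒦TJ (J n r) ≐ ｛ s ｝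
  case₂ n≡2s (f , g) = [ (λ e → e) , trans (sym n∸s≡s) ]′ ∘ f , g ∘ inj₁
    where
    n∸s≡s : n ∸ s ≡ s
    n∸s≡s = trans (cong (_∸ s) n≡2s) (trans (m+n∸m≡n s (s + 0)) (+-identityʳ s))
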